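{- For every integer $n\geq 1$, the number of factors in the (self-referencing) LZ factorization of the $n$-th Thue-Morse word $t_n$ is $z(t_n)=2n$.
   Context: Strings are over the binary alphabet $\Sigma=\{\mathtt{a},\mathtt{b}\}$; $|w|$ denotes the length of $w$. For $w\in\Sigma^*$, $\overline{w}$ is the string obtained from $w$ by exchanging all $\mathtt{a}$'s and $\mathtt{b}$'s. Thue-Morse words: $t_0=\mathtt{a}$, and $t_n=t_{n-1}\overline{t_{n-1}}$ for $n>0$ (so $|t_n|=2^n$). LZ factorization (with self-reference): the LZ factorization of a string $w$ is the sequence $f_1,\ldots,f_z$ of non-empty strings such that $w=f_1\cdots f_z$ and, for every $1\le i\le z$, $f_i$ is the longest (non-empty) prefix of $f_i\cdots f_z$ which has at least two occurrences in $f_1\cdots f_i$, or $|f_i|=1$ if no such non-empty prefix exists. The two occurrences may overlap. The number $z$ of factors is denoted $z(w)$. -}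

module Defs where

open import Data.Empty using (⊥-elim)
open import Data.List.Base using (List; []; _∷_; _++_; map; concat; length; take)
open import Data.List.Properties
  using (++-assoc; ++-identityʳ; ++-cancelˡ; length-++; ∷-injective; ∷-injectiveʳ)
open import Data.List.Relation.Binary.Pointwise using (Pointwise-≡⇒≡)
open import Data.List.Relation.Binary.Prefix.Heterogeneous using (Prefix; []; _∷_; _++ᵖ_; toView)
  renaming (_++_ to _++ᵛ_)
open import Data.List.Relation.Binary.Prefix.Heterogeneous.Properties using (length-mono; prefix?)
open import Data.List.Relation.Unary.All using (All; []; _∷_)
open import Data.Nat.Base using (ℕ; zero; suc; _≤_; _<_; z≤n; s≤s; s≤s⁻¹)
open import Data.Nat.Properties
  using (≤-refl; ≤-trans; ≤-antisym; m≤m+n; m≤n⇒m<n∨m≡n; m≤n+m; suc-injective; anyUpTo?)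
open import Data.Product.Base using (∃; ∃₂; _×_; _,_; proj₁; proj₂)
open import Data.Sum.Base using (_⊎_; inj₁; inj₂)
open import Relation.Binary.Definitions using (DecidableEquality)
open import Relation.Binary.PropositionalEquality
  using (_≡_; _≢_; refl; sym; trans; cong; subst)
open import Relation.Nullary using (Dec; yes; no; ¬_)
open import Relation.Nullary.Decidable using (map′; _×-dec_)

data Letter : Set where
  a b : Letter

String : Set
String = List Letter

swap : Letter → Letter
swap a = b
swap b = a

complement : String → String
complement = map swap

t : ℕ → String
t zero    = a ∷ []
t (suc n) = t n ++ complement (t n)

OccursAt : String → String → ℕ → Set
OccursAt u w i = ∃₂ λ x y → w ≡ x ++ u ++ y × length x ≡ i

OccursTwice : String → String → Set
OccursTwice u w = ∃₂ λ i j → i < j × OccursAt u w i × OccursAt u w j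

-- The text already factorized is p and the remaining text is s.  A candidate
-- u is judged inside p ++ u, the text ending where u itself ends, so that one of
-- the occurrences may be u itself and the other may overlap it.
record Candidate (p s u : String) : Set where
  constructor candidate
  field
    nonEmpty : u ≢ []
    prefix   : Prefix _≡_ u s
    twice    : OccursTwice u (p ++ u)

LongestCandidate : String → String → String → Set
LongestCandidate p s u = Candidate p s u × (∀ v → Candidate p s v → length v ≤ length u)

-- f is the LZ factor following p in the text p ++ f ++ r.
IsLZFactor : (p f r : String) → Set
IsLZFactor p f r =
  LongestCandidate p (f ++ r) f ⊎ (¬ ∃ (Candidate p (f ++ r))) × length f ≡ 1

record IsLZFactorization (w : String) (fs : List String) : Set where
  field
    concat≡  : concat fs ≡ w
    nonEmpty : All (_≢ []) fs
    factor   : ∀ ps f rs → fs ≡ ps ++ f ∷ rs → IsLZFactor (concat ps) f (concat rs)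

-- Every string has exactly one LZ factorization, which makes z a function.

private

  _≟_ : DecidableEquality Letter
  a ≟ a = yes refl
  a ≟ b = no λ ()
  b ≟ a = no λ ()
  b ≟ b = yes refl

  prefix⇒++ : ∀ {u w : String} → Prefix _≡_ u w → ∃ λ y → w ≡ u ++ y
  prefix⇒++ p with toView p
  ... | eqs ++ᵛ y = y , cong (_++ y) (sym (Pointwise-≡⇒≡ eqs))

  prefix-refl : ∀ (u : String) → Prefix _≡_ u u
  prefix-refl []      = []
  prefix-refl (c ∷ u) = refl ∷ prefix-refl u

  ++⇒prefix : ∀ (u {y} : String) → Prefix _≡_ u (u ++ y)
  ++⇒prefix u {y} = prefix-refl u ++ᵖ y

  prefix⇒take : ∀ {u s : String} → Prefix _≡_ u s → take (length u) s ≡ u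
  prefix⇒take []         = refl
  prefix⇒take (refl ∷ p) = cong (_ ∷_) (prefix⇒take p)

  prefix-unique : ∀ {u v s : String} → Prefix _≡_ u s → Prefix _≡_ v s →
                  length u ≡ length v → u ≡ v
  prefix-unique {s = s} p q eq =
    trans (sym (prefix⇒take p)) (trans (cong (λ n → take n s) eq) (prefix⇒take q))

  occursAt? : ∀ u w i → Dec (OccursAt u w i)
  occursAt? u w zero = map′ to from (prefix? _≟_ u w)
    where
    to : Prefix _≡_ u w → OccursAt u w 0
    to p = [] , proj₁ (prefix⇒++ p) , proj₂ (prefix⇒++ p) , refl
    from : OccursAt u w 0 → Prefix _≡_ u w
    from ([] , y , refl , _) = ++⇒prefix u
  occursAt? u [] (suc i) = no λ { ([] , _ , _ , ()) ; (_ ∷ _ , _ , () , _) }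
  occursAt? u (c ∷ w) (suc i) = map′ to from (occursAt? u w i)
    where
    to : OccursAt u w i → OccursAt u (c ∷ w) (suc i)
    to (x , y , eq , l) = c ∷ x , y , cong (c ∷_) eq , cong suc l
    from : OccursAt u (c ∷ w) (suc i) → OccursAt u w i
    from (_ ∷ x , y , eq , l) = x , y , ∷-injectiveʳ eq , suc-injective l

  occursAt-bound : ∀ {u w i} → OccursAt u w i → i < suc (length w)
  occursAt-bound {u} (x , y , refl , refl) =
    s≤s (subst (length x ≤_) (sym (length-++ x)) (m≤m+n (length x) _))

  occursTwice? : ∀ u w → Dec (OccursTwice u w)
  occursTwice? u w = map′ to from
    (anyUpTo? (λ j → occursAt? u w j ×-dec anyUpTo? (occursAt? u w) j) (suc (length w)))
    where
    Bounded : Set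
    Bounded = ∃ λ j → j < suc (length w) × OccursAt u w j ×
                (∃ λ i → i < j × OccursAt u w i)
    to : Bounded → OccursTwice u w
    to (j , _ , oj , i , i<j , oi) = i , j , i<j , oi , oj
    from : OccursTwice u w → Bounded
    from (i , j , i<j , oi , oj) = j , occursAt-bound oj , oj , i , i<j , oi

  candidate? : ∀ p s u → Dec (Candidate p s u)
  candidate? p s u = map′
    (λ (n , q , o) → candidate n q o)
    (λ (candidate n q o) → n , q , o)
    (nonEmpty? u ×-dec prefix? _≟_ u s ×-dec occursTwice? u (p ++ u))
    where
    nonEmpty? : ∀ (u : String) → Dec (u ≢ [])
    nonEmpty? []      = no λ ne → ne refl
    nonEmpty? (_ ∷ _) = yes λ ()

  longestUpTo : ∀ p s n →
    (∃ λ u → Candidate p s u × (∀ v → Candidate p s v → length v ≤ n → length v ≤ length u))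
    ⊎ (∀ v → Candidate p s v → ¬ length v ≤ n)
  longestUpTo p s zero = inj₂ λ
    { []      c _ → Candidate.nonEmpty c refl
    ; (_ ∷ _) c () }
  longestUpTo p s (suc n) with candidate? p s (take (suc n) s)
  ... | yes c = inj₁ (take (suc n) s , c , bound)
    where
    bound : ∀ v → Candidate p s v → length v ≤ suc n → length v ≤ length (take (suc n) s)
    bound v cv l = go (suc n) (Candidate.prefix cv) l
      where
      go : ∀ k {v s : String} → Prefix _≡_ v s → length v ≤ k → length v ≤ length (take k s)
      go k       []      _ = z≤n
      go (suc k) (_ ∷ p) l = s≤s (go k p (s≤s⁻¹ l))
  ... | no ¬c = extend (longestUpTo p s n)
    where
    shorter : ∀ v → Candidate p s v → length v ≤ suc n → length v ≤ n
    shorter v cv l with m≤n⇒m<n∨m≡n l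
    ... | inj₁ l′ = s≤s⁻¹ l′
    ... | inj₂ eq = ⊥-elim (¬c (subst (Candidate p s)
                      (trans (sym (prefix⇒take (Candidate.prefix cv))) (cong (λ k → take k s) eq)) cv))
    extend :
      (∃ λ u → Candidate p s u × (∀ v → Candidate p s v → length v ≤ n → length v ≤ length u))
      ⊎ (∀ v → Candidate p s v → ¬ length v ≤ n) →
      (∃ λ u → Candidate p s u × (∀ v → Candidate p s v → length v ≤ suc n → length v ≤ length u))
      ⊎ (∀ v → Candidate p s v → ¬ length v ≤ suc n)
    extend (inj₁ (u , cu , h)) = inj₁ (u , cu , λ v cv l → h v cv (shorter v cv l))
    extend (inj₂ h)            = inj₂ λ v cv l → h v cv (shorter v cv l)

  nextFactor : ∀ p c s → ∃₂ λ f r → f ++ r ≡ c ∷ s × IsLZFactor p f r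
  nextFactor p c s with longestUpTo p (c ∷ s) (length (c ∷ s))
  ... | inj₂ none = c ∷ [] , s , refl ,
          inj₂ ((λ (v , cv) → none v cv (length-mono (Candidate.prefix cv))) , refl)
  ... | inj₁ (u , cu , h) with prefix⇒++ (Candidate.prefix cu)
  ...   | r , eq = u , r , sym eq , inj₁ (subst (λ s′ → LongestCandidate p s′ u) eq
                     (cu , λ v cv → h v cv (length-mono (Candidate.prefix cv))))

  factor-nonEmpty : ∀ {p} f {r} → IsLZFactor p f r → f ≢ []
  factor-nonEmpty f  (inj₁ (c , _)) = Candidate.nonEmpty c
  factor-nonEmpty [] (inj₂ (_ , ()))
  factor-nonEmpty (_ ∷ _) (inj₂ _)  = λ ()

  factor-unique : ∀ {p} f {r} f′ {r′} → f ++ r ≡ f′ ++ r′ →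
                  IsLZFactor p f r → IsLZFactor p f′ r′ → f ≡ f′
  factor-unique {p} f {r} f′ {r′} eq F F′ =
    prefix-unique (++⇒prefix f) (subst (Prefix _≡_ f′) (sym eq) (++⇒prefix f′)) (lengths F F′)
    where
    lengths : IsLZFactor p f r → IsLZFactor p f′ r′ → length f ≡ length f′
    lengths F F′ rewrite eq with F | F′
    ... | inj₁ (c , h)  | inj₁ (c′ , h′) = ≤-antisym (h′ f c) (h f′ c′)
    ... | inj₁ (c , _)  | inj₂ (n , _)   = ⊥-elim (n (f , c))
    ... | inj₂ (n , _)  | inj₁ (c , _)   = ⊥-elim (n (f′ , c))
    ... | inj₂ (_ , l)  | inj₂ (_ , l′)  = trans l (sym l′)

  FactorsAfter : String → List String → Set
  FactorsAfter p fs = ∀ ps f rs → fs ≡ ps ++ f ∷ rs → IsLZFactor (p ++ concat ps) f (concat rs)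

  headFactor : ∀ {p f fs} → FactorsAfter p (f ∷ fs) → IsLZFactor p f (concat fs)
  headFactor {p} {f} {fs} F =
    subst (λ q → IsLZFactor q f (concat fs)) (++-identityʳ p) (F [] f fs refl)

  tailFactors : ∀ {p f fs} → FactorsAfter p (f ∷ fs) → FactorsAfter (p ++ f) fs
  tailFactors {p} {f} F ps g rs eq =
    subst (λ q → IsLZFactor q g (concat rs)) (sym (++-assoc p f (concat ps)))
      (F (f ∷ ps) g rs (cong (f ∷_) eq))

  consFactors : ∀ {p f fs} → IsLZFactor p f (concat fs) → FactorsAfter (p ++ f) fs →
                FactorsAfter p (f ∷ fs)
  consFactors {p} {f} {fs} F Fs [] g rs refl =
    subst (λ q → IsLZFactor q f (concat fs)) (sym (++-identityʳ p)) F
  consFactors {p} {f} F Fs (h ∷ ps) g rs eq with ∷-injective eq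
  ... | refl , eq′ = subst (λ q → IsLZFactor q g (concat rs)) (++-assoc p f (concat ps))
                       (Fs ps g rs eq′)

  exists : ∀ n p s → length s ≤ n →
           ∃ λ fs → concat fs ≡ s × All (_≢ []) fs × FactorsAfter p fs
  exists n p [] _ = [] , refl , [] , λ { [] _ _ () ; (_ ∷ _) _ _ () }
  exists (suc n) p (c ∷ s) l with nextFactor p c s
  ... | [] , r , eq , F = ⊥-elim (factor-nonEmpty [] F refl)
  ... | f@(_ ∷ f′) , r , eq , F with exists n (p ++ f) r shorter
    where
    shorter : length r ≤ n
    shorter = ≤-trans
      (subst (length r ≤_) (trans (sym (length-++ f′)) (cong length (∷-injectiveʳ eq))) (m≤n+m (length r) (length f′)))
      (s≤s⁻¹ l)
  ...   | fs , refl , ne , Fs = f ∷ fs , eq , (λ ()) ∷ ne , consFactors F Fs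

  unique : ∀ p fs gs → concat fs ≡ concat gs → All (_≢ []) fs → All (_≢ []) gs →
           FactorsAfter p fs → FactorsAfter p gs → fs ≡ gs
  unique p [] [] _ _ _ _ _ = refl
  unique p [] ([] ∷ gs) _ _ (ne ∷ _) _ _ = ⊥-elim (ne refl)
  unique p ([] ∷ fs) [] _ (ne ∷ _) _ _ _ = ⊥-elim (ne refl)
  unique p (f ∷ fs) (g ∷ gs) eq (_ ∷ nf) (_ ∷ ng) F G
    with factor-unique f g eq (headFactor F) (headFactor G)
  ... | refl = cong (f ∷_) (unique (p ++ f) fs gs (++-cancelˡ f _ _ eq) nf ng
                 (tailFactors F) (tailFactors G))

lzFactorization : ∀ w → ∃ (IsLZFactorization w)
lzFactorization w with exists (length w) [] w ≤-refl
... | fs , eq , ne , F = fs , record { concat≡ = eq ; nonEmpty = ne ; factor = F }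

lzFactorization-unique : ∀ {w fs gs} → IsLZFactorization w fs → IsLZFactorization w gs → fs ≡ gs
lzFactorization-unique {fs = fs} {gs} F G =
  unique [] fs gs (trans F.concat≡ (sym G.concat≡)) F.nonEmpty G.nonEmpty F.factor G.factor
  where
  module F = IsLZFactorization F
  module G = IsLZFactorization G

z : String → ℕ
z w = length (proj₁ (lzFactorization w))

{-# OPTIONS --safe #-}
-- Beyond its first seven factors, the factorization of the infinite Thue–Morse word is
-- self-similar under the morphism μ : a ↦ ab, b ↦ ba.  If the factor at position i has length l,
-- then μ carries its earlier occurrence to one of length 2l for position 2i.  Conversely, two
-- equal factors of length at least 5 start at positions of the same parity, since otherwise
-- the common factor would alternate and come from a cube of a letter.  So a longer
-- factor reoccurring at 2i would start at an even position and could be halved.  The factors of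
-- lengths 7 and 6 at positions 13 and 20 thus generate, by doubling, the factors at 26, 40, 52, …;
-- each doubling of the text adds two factors, and the end of the text cuts the factor at
-- 13 · 2ᵐ down to length 3 · 2ᵐ.
module Submission where

open import Defs
open import Data.Bool.Base using (Bool; true; false)
open import Data.Empty using (⊥-elim)
open import Data.List.Base using (List; []; _∷_; _++_; map; concat; length; take)
open import Data.List.Properties
  using (++-assoc; ++-identityʳ; length-++; length-map; ∷-injective; ≡-dec)
open import Data.List.Relation.Binary.Pointwise using (Pointwise-≡⇒≡; ≡⇒Pointwise-≡)
open import Data.List.Relation.Binary.Prefix.Heterogeneous using (Prefix; toView; fromView)
  renaming (_++_ to _++ᵛ_)
open import Data.List.Relation.Unary.All using (All; []; _∷_)
import Data.List.Relation.Unary.All as All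
open import Data.List.Relation.Unary.All.Properties using (map⁺)
open import Data.Nat.Base using (ℕ; zero; suc; _+_; _*_; _^_; _≤_; _<_; _≥_; z≤n; s≤s)
open import Data.Nat.ListAction using (sum)
open import Data.Nat.Properties
  using (≤-trans; <-≤-trans; ≮⇒≥; m≤m+n; m≤n⇒∃[o]m+o≡n; <⇒≤; *-cancelˡ-<;
         *-monoʳ-<; *-monoʳ-≤; *-suc; *-distribˡ-+; +-assoc; +-suc; +-identityʳ; +-cancelʳ-≤; anyUpTo?)
open import Data.Nat.Tactic.RingSolver using (solve-∀)
open import Data.Product.Base using (∃; _×_; _,_; proj₁; proj₂)
open import Data.Sum.Base using (_⊎_; inj₁; inj₂)
open import Function.Base using (_∘_)
open import Relation.Binary.Definitions using (DecidableEquality)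
open import Relation.Binary.PropositionalEquality
  using (_≡_; _≢_; refl; sym; trans; cong; cong₂; subst; module ≡-Reasoning)
open import Relation.Nullary using (Dec; yes; no; ¬_)
open import Relation.Nullary.Decidable using (from-yes; from-no)

_≟_ : DecidableEquality Letter
a ≟ a = yes refl
a ≟ b = no λ ()
b ≟ a = no λ ()
b ≟ b = yes refl

swap-involutive : ∀ c → swap (swap c) ≡ c
swap-involutive a = refl
swap-involutive b = refl

c≢swap-c : ∀ c → c ≢ swap c
c≢swap-c a ()
c≢swap-c b ()

-- The infinite Thue–Morse word

increment : List Bool → List Bool
increment []           = true ∷ []
increment (false ∷ ds) = true ∷ ds
increment (true ∷ ds)  = false ∷ increment ds

-- Least significant digit first.
digits : ℕ → List Bool
digits zero    = []
digits (suc n) = increment (digits n)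

digitSum : List Bool → Letter
digitSum []           = a
digitSum (false ∷ ds) = digitSum ds
digitSum (true ∷ ds)  = swap (digitSum ds)

-- The parity of the number of ones in binary. Letters at concrete positions evaluate, so the
-- finitely many base cases below can be settled by decision procedures.
tm : ℕ → Letter
tm n = digitSum (digits n)

-- Odd numbers come first because `digits 0` is empty: `digits (2 * n)` is not `false ∷ digits n` at
-- `n = 0`, and the even case is obtained as one further increment.
digits-odd : ∀ n → digits (suc (2 * n)) ≡ true ∷ digits n
digits-odd zero    = refl
digits-odd (suc n) =
  trans (cong (digits ∘ suc) (*-suc 2 n)) (cong (increment ∘ increment) (digits-odd n))

tm-odd : ∀ n → tm (suc (2 * n)) ≡ swap (tm n)
tm-odd n = cong digitSum (digits-odd n)

tm-even : ∀ n → tm (2 * n) ≡ tm n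
tm-even zero    = refl
tm-even (suc n) =
  trans (cong tm (*-suc 2 n)) (cong (digitSum ∘ increment) (digits-odd n))

parity : ∀ n → (∃ λ k → n ≡ 2 * k) ⊎ (∃ λ k → n ≡ suc (2 * k))
parity zero = inj₁ (0 , refl)
parity (suc n) with parity n
... | inj₁ (k , refl) = inj₂ (k , refl)
... | inj₂ (k , refl) = inj₁ (suc k , sym (*-suc 2 k))

tm-even≢tm-odd : ∀ k → tm (2 * k) ≢ tm (suc (2 * k))
tm-even≢tm-odd k eq = c≢swap-c (tm k) (trans (sym (tm-even k)) (trans eq (tm-odd k)))

-- One of `i` and `suc i` is even and so starts an aligned block `2 * k`, `suc (2 * k)`, whose two
-- letters differ.
tm-cube-free : ∀ i → tm i ≡ tm (suc i) → tm (suc i) ≢ tm (suc (suc i))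
tm-cube-free i eq eq′ with parity i
... | inj₁ (k , refl) = tm-even≢tm-odd k eq
... | inj₂ (k , refl) =
  tm-even≢tm-odd (suc k) (subst (λ m → tm m ≡ tm (suc m)) (sym (*-suc 2 k)) eq′)

segment : ℕ → ℕ → String
segment i zero    = []
segment i (suc l) = tm i ∷ segment (suc i) l

length-segment : ∀ i l → length (segment i l) ≡ l
length-segment i zero    = refl
length-segment i (suc l) = cong suc (length-segment (suc i) l)

segment-++ : ∀ i l m → segment i l ++ segment (i + l) m ≡ segment i (l + m)
segment-++ i zero    m = cong (λ k → segment k m) (+-identityʳ i)
segment-++ i (suc l) m = cong (tm i ∷_)
  (trans (cong (λ k → segment (suc i) l ++ segment k m) (+-suc i l)) (segment-++ (suc i) l m))

segment-split : ∀ i l x {y} → segment i l ≡ x ++ y →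
  x ≡ segment i (length x) × y ≡ segment (i + length x) (length y) × l ≡ length x + length y
segment-split i l [] refl rewrite +-identityʳ i | length-segment i l = refl , refl , refl
segment-split i (suc l) (c ∷ x) eq with ∷-injective eq
... | refl , eq′ with segment-split (suc i) l x eq′
...   | eqx , eqy , eql rewrite +-suc i (length x) = cong (tm i ∷_) eqx , eqy , cong suc eql

take-segment : ∀ {m l} i → m ≤ l → take m (segment i l) ≡ segment i m
take-segment i z≤n       = refl
take-segment i (s≤s m≤l) = cong (tm i ∷_) (take-segment (suc i) m≤l)

-- The doubling morphism

μ : String → String
μ []      = []
μ (c ∷ w) = c ∷ swap c ∷ μ w

μ-++ : ∀ v w → μ (v ++ w) ≡ μ v ++ μ w
μ-++ []      w = refl
μ-++ (c ∷ v) w = cong (λ u → c ∷ swap c ∷ u) (μ-++ v w)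

μ-complement : ∀ w → μ (complement w) ≡ complement (μ w)
μ-complement []      = refl
μ-complement (c ∷ w) = cong (λ u → swap c ∷ swap (swap c) ∷ u) (μ-complement w)

μ-t : ∀ n → μ (t n) ≡ t (suc n)
μ-t zero    = refl
μ-t (suc n) = begin
  μ (t n ++ complement (t n))            ≡⟨ μ-++ (t n) _ ⟩
  μ (t n) ++ μ (complement (t n))        ≡⟨ cong (μ (t n) ++_) (μ-complement (t n)) ⟩
  μ (t n) ++ complement (μ (t n))        ≡⟨ cong (λ w → w ++ complement w) (μ-t n) ⟩
  t (suc n) ++ complement (t (suc n))    ∎
  where open ≡-Reasoning

μ-segment : ∀ i l → μ (segment i l) ≡ segment (2 * i) (2 * l)
μ-segment i zero    = refl
μ-segment i (suc l) = begin
  tm i ∷ swap (tm i) ∷ μ (segment (suc i) l)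
    ≡⟨ cong₂ (λ c d → c ∷ d ∷ μ (segment (suc i) l)) (tm-even i) (tm-odd i) ⟨
  tm (2 * i) ∷ tm (suc (2 * i)) ∷ μ (segment (suc i) l)
    ≡⟨ cong (λ w → tm (2 * i) ∷ tm (suc (2 * i)) ∷ w)
         (trans (μ-segment (suc i) l) (cong (λ k → segment k (2 * l)) (*-suc 2 i))) ⟩
  segment (2 * i) (2 + 2 * l)
    ≡⟨ cong (segment (2 * i)) (*-suc 2 l) ⟨
  segment (2 * i) (2 * suc l) ∎
  where open ≡-Reasoning

-- `t` grows by appending a complement, `tm` recurses on the lowest digit; both turn into iteration
-- of `μ`.
t≡segment : ∀ n → t n ≡ segment 0 (2 ^ n)
t≡segment zero    = refl
t≡segment (suc n) =
  trans (sym (μ-t n)) (trans (cong μ (t≡segment n)) (μ-segment 0 (2 ^ n)))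

-- A left inverse of `μ` that also keeps an unpaired last letter, so that length `2 * l + 1` halves
-- to `l + 1`.
evens : String → String
evens []          = []
evens (c ∷ [])    = c ∷ []
evens (c ∷ _ ∷ w) = c ∷ evens w

evens-segment : ∀ i l → evens (segment (2 * i) (suc (2 * l))) ≡ segment i (suc l)
evens-segment i zero    = cong (_∷ []) (tm-even i)
evens-segment i (suc l) = trans
  (cong (evens ∘ segment (2 * i) ∘ suc) (*-suc 2 l))
  (cong₂ _∷_ (tm-even i)
    (trans (cong (λ k → evens (segment k (suc (2 * l)))) (sym (*-suc 2 i)))
      (evens-segment (suc i) l)))

-- The common factor x x̄ y ȳ z would satisfy x̄ ≠ y and ȳ ≠ z, so x = y = z.
segment-synchronized : ∀ i j → segment (2 * i) 5 ≢ segment (suc (2 * j)) 5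
segment-synchronized i j eq
  with _ , eq ← ∷-injective eq
  with eq₁ , eq ← ∷-injective eq
  with eq₂ , eq ← ∷-injective eq
  with eq₃ , eq ← ∷-injective eq
  with eq₄ , _ ← ∷-injective eq
  = tm-cube-free i
      (same i (suc j)
        (trans eq₁ (cong tm (sym (*-suc 2 j))))
        (trans (cong tm (*-suc 2 i)) (trans eq₂ (cong (tm ∘ suc) (sym (*-suc 2 j))))))
      (same (suc i) (suc (suc j))
        (trans (cong (tm ∘ suc) (*-suc 2 i)) (trans eq₃ (cong tm (sym (2+2+ j)))))
        (trans (cong tm (2+2+ i)) (trans eq₄ (cong (tm ∘ suc) (sym (2+2+ j))))))
  where
  2+2+ : ∀ m → 2 * suc (suc m) ≡ 4 + 2 * m
  2+2+ = solve-∀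
  same : ∀ x y → tm (suc (2 * x)) ≡ tm (2 * y) → tm (2 * suc x) ≡ tm (suc (2 * y)) →
         tm x ≡ tm (suc x)
  same x y eq eq′ = begin
    tm x               ≡⟨ swap-involutive (tm x) ⟨
    swap (swap (tm x)) ≡⟨ cong swap (tm-odd x) ⟨
    swap (tm (suc (2 * x))) ≡⟨ cong swap (trans eq (tm-even y)) ⟩
    swap (tm y)        ≡⟨ tm-odd y ⟨
    tm (suc (2 * y))   ≡⟨ eq′ ⟨
    tm (2 * suc x)     ≡⟨ tm-even (suc x) ⟩
    tm (suc x)         ∎
    where open ≡-Reasoning

-- Earlier occurrences

-- `j + l` may exceed `i`: overlap is what self-reference permits.
Reoccurs : ℕ → ℕ → Set
Reoccurs i l = ∃ λ j → j < i × segment j l ≡ segment i l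

reoccurs? : ∀ i l → Dec (Reoccurs i l)
reoccurs? i l = anyUpTo? (λ j → ≡-dec _≟_ (segment j l) (segment i l)) i

segment-≡-shorten : ∀ {i j l m} → m ≤ l → segment j l ≡ segment i l → segment j m ≡ segment i m
segment-≡-shorten {i} {j} {m = m} m≤l eq =
  trans (sym (take-segment j m≤l)) (trans (cong (take m) eq) (take-segment i m≤l))

reoccurs-shorten : ∀ {i l m} → m ≤ l → Reoccurs i l → Reoccurs i m
reoccurs-shorten m≤l (j , j<i , eq) = j , j<i , segment-≡-shorten m≤l eq

reoccurs-double : ∀ {i l} → Reoccurs i l → Reoccurs (2 * i) (2 * l)
reoccurs-double {i} {l} (j , j<i , eq) =
  2 * j , *-monoʳ-< 2 j<i , trans (sym (μ-segment j l)) (trans (cong μ eq) (μ-segment i l))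

-- A single letter beyond the doubled length suffices: it opens a new block, and a block is
-- determined by its first letter. `2 ≤ l` supplies the five letters that exclude an odd `j`.
reoccurs-halve : ∀ {i l} → 2 ≤ l → Reoccurs (2 * i) (suc (2 * l)) → Reoccurs i (suc l)
reoccurs-halve {i} {l} 2≤l (j , j<2i , eq) with parity j
... | inj₁ (k , refl) = k , *-cancelˡ-< 2 k i j<2i ,
  trans (sym (evens-segment k l)) (trans (cong evens eq) (evens-segment i l))
... | inj₂ (k , refl) = ⊥-elim (segment-synchronized i k
  (sym (segment-≡-shorten (s≤s (*-monoʳ-≤ 2 2≤l)) eq)))

-- Factorizations of the infinite word, described by lengths

data Factor (i : ℕ) : (l r : ℕ) → Set where
  literal : ∀ {r} → ¬ Reoccurs i 1 → Factor i 1 r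
  maximal : ∀ {l r} → Reoccurs i (suc l) → ¬ Reoccurs i (suc (suc l)) → Factor i (suc l) r
  final   : ∀ {l} → Reoccurs i (suc l) → Factor i (suc l) 0

factor-double : ∀ {i l r} → 2 ≤ l → Factor i l r → Factor (2 * i) (2 * l) (2 * r)
factor-double (s≤s ()) (literal _)
factor-double 2≤l (maximal o ¬o) = maximal (reoccurs-double o) (¬o ∘ reoccurs-halve 2≤l)
factor-double 2≤l (final o)      = final (reoccurs-double o)

data Factorized : ℕ → List ℕ → Set where
  []  : ∀ {i} → Factorized i []
  _∷_ : ∀ {i l ls} → Factor i l (sum ls) → Factorized (i + l) ls → Factorized i (l ∷ ls)

sum-double : ∀ ls → sum (map (2 *_) ls) ≡ 2 * sum ls
sum-double []       = refl
sum-double (l ∷ ls) = trans (cong (2 * l +_) (sum-double ls)) (sym (*-distribˡ-+ 2 l (sum ls)))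

factorized-double : ∀ {i ls} → All (2 ≤_) ls → Factorized i ls →
                    Factorized (2 * i) (map (2 *_) ls)
factorized-double []            []       = []
factorized-double {i} {l ∷ ls} (2≤l ∷ 2≤ls) (F ∷ Fs) =
  subst (Factor (2 * i) (2 * l)) (sym (sum-double ls)) (factor-double 2≤l F) ∷
  subst (λ k → Factorized k (map (2 *_) ls)) (*-distribˡ-+ 2 i l) (factorized-double 2≤ls Fs)

-- From factor lengths to the LZ factorization

prefix⇒++ : ∀ {u w : String} → Prefix _≡_ u w → ∃ λ y → w ≡ u ++ y
prefix⇒++ p with toView p
... | eqs ++ᵛ y = y , cong (_++ y) (sym (Pointwise-≡⇒≡ eqs))

-- The later occurrence has to fit into a text of length `i + length v`, so it starts at `i` or
-- before, and the earlier one strictly before `i`.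
candidate⇒reoccurs : ∀ {i l v} → Candidate (segment 0 i) (segment i l) v →
                     length v ≤ l × Reoccurs i (length v)
candidate⇒reoccurs {i} {l} {v}
  (candidate _ pre (_ , _ , m<n , (x , y , eq , refl) , (x′ , y′ , eq′ , refl)))
  with prefix⇒++ pre
... | s , eqs with segment-split i l v eqs
...   | eqv , _ , eql =
  subst (length v ≤_) (sym eql) (m≤m+n (length v) (length s)) ,
  length x , <-≤-trans m<n x′≤i , trans (sym v-at-x) eqv
  where
  text : segment 0 i ++ v ≡ segment 0 (i + length v)
  text = trans (cong (segment 0 i ++_) eqv) (segment-++ 0 i (length v))

  v-at-x : v ≡ segment (length x) (length v)
  v-at-x with segment-split 0 (i + length v) x (trans (sym text) eq)
  ... | _ , eqr , _ = proj₁ (segment-split (length x) _ v (sym eqr))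

  x′≤i : length x′ ≤ i
  x′≤i with segment-split 0 (i + length v) x′ (trans (sym text) eq′)
  ... | _ , _ , eqn = +-cancelʳ-≤ (length v) (length x′) i
    (subst (length x′ + length v ≤_)
      (sym (trans eqn (trans (cong (length x′ +_) (length-++ v))
        (sym (+-assoc (length x′) (length v) (length y′))))))
      (m≤m+n (length x′ + length v) (length y′)))

reoccurs⇒candidate : ∀ {i l} r → Reoccurs i (suc l) →
                     Candidate (segment 0 i) (segment i (suc l) ++ r) (segment i (suc l))
reoccurs⇒candidate {i} {l} r (j , j<i , eq) = candidate (λ ())
  (fromView (≡⇒Pointwise-≡ refl ++ᵛ r))
  (j , i , j<i , at-j ,
    (segment 0 i , [] , cong (segment 0 i ++_) (sym (++-identityʳ u)) , length-segment 0 i))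
  where
  open ≡-Reasoning
  u = segment i (suc l)
  d = proj₁ (m≤n⇒∃[o]m+o≡n (<⇒≤ j<i))
  j+d≡i = proj₂ (m≤n⇒∃[o]m+o≡n (<⇒≤ j<i))
  exchange : ∀ x y z → (x + y) + z ≡ x + (z + y)
  exchange = solve-∀
  at-j : OccursAt u (segment 0 i ++ u) j
  -- The text has length `i + suc l`, so exactly `d = i - j` letters follow the earlier occurrence,
  -- whether or not it overlaps the later one.
  at-j = segment 0 j , segment (j + suc l) d , (begin
    segment 0 i ++ segment i (suc l)     ≡⟨ segment-++ 0 i (suc l) ⟩
    segment 0 (i + suc l)                ≡⟨ cong (λ k → segment 0 (k + suc l)) j+d≡i ⟨
    segment 0 ((j + d) + suc l)          ≡⟨ cong (segment 0) (exchange j d (suc l)) ⟩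
    segment 0 (j + (suc l + d))          ≡⟨ segment-++ 0 j (suc l + d) ⟨
    segment 0 j ++ segment j (suc l + d) ≡⟨ cong (segment 0 j ++_) (segment-++ j (suc l) d) ⟨
    segment 0 j ++ segment j (suc l) ++ segment (j + suc l) d
      ≡⟨ cong (λ w → segment 0 j ++ w ++ segment (j + suc l) d) eq ⟩
    segment 0 j ++ u ++ segment (j + suc l) d ∎) , length-segment 0 j

-- Reoccurrence passes to shorter lengths, so failure at one length rules out every longer
-- candidate. In the `final` case nothing remains after the factor, and no candidate outgrows the
-- text.
factor⇒isLZFactor : ∀ {i l r} → Factor i l r →
                    IsLZFactor (segment 0 i) (segment i l) (segment (i + l) r)
factor⇒isLZFactor {i} {l} {r} F = go F
  where
  reoccurs : ∀ v → Candidate (segment 0 i) (segment i l ++ segment (i + l) r) v →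
             length v ≤ l + r × Reoccurs i (length v)
  reoccurs v = candidate⇒reoccurs ∘ subst (λ s → Candidate (segment 0 i) s v) (segment-++ i l r)

  go : Factor i l r → IsLZFactor (segment 0 i) (segment i l) (segment (i + l) r)
  go (literal ¬o) = inj₂ (none , refl)
    where
    none : ¬ ∃ (Candidate (segment 0 i) (segment i 1 ++ segment (i + 1) r))
    none ([]        , c) = Candidate.nonEmpty c refl
    none (v@(_ ∷ _) , c) = ¬o (reoccurs-shorten (s≤s z≤n) (proj₂ (reoccurs v c)))
  go (maximal o ¬o) = inj₁ (reoccurs⇒candidate _ o , λ v c →
    subst (length v ≤_) (sym (length-segment i l))
      (≮⇒≥ λ l<v → ¬o (reoccurs-shorten l<v (proj₂ (reoccurs v c)))))
  go (final o) = inj₁ (reoccurs⇒candidate _ o , λ v c →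
    subst (length v ≤_) (trans (+-identityʳ l) (sym (length-segment i l))) (proj₁ (reoccurs v c)))

cut : ℕ → List ℕ → List String
cut i []       = []
cut i (l ∷ ls) = segment i l ∷ cut (i + l) ls

length-cut : ∀ i ls → length (cut i ls) ≡ length ls
length-cut i []       = refl
length-cut i (l ∷ ls) = cong suc (length-cut (i + l) ls)

concat-cut : ∀ i ls → concat (cut i ls) ≡ segment i (sum ls)
concat-cut i []       = refl
concat-cut i (l ∷ ls) =
  trans (cong (segment i l ++_) (concat-cut (i + l) ls)) (segment-++ i l (sum ls))

factor-nonEmpty : ∀ {i l r} → Factor i l r → segment i l ≢ []
factor-nonEmpty (literal _)   ()
factor-nonEmpty (maximal _ _) ()
factor-nonEmpty (final _)     ()

cut-nonEmpty : ∀ {i ls} → Factorized i ls → All (_≢ []) (cut i ls)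
cut-nonEmpty []       = []
cut-nonEmpty (F ∷ Fs) = factor-nonEmpty F ∷ cut-nonEmpty Fs

cut-factor : ∀ {i ls} → Factorized i ls → ∀ ps f rs → cut i ls ≡ ps ++ f ∷ rs →
             IsLZFactor (segment 0 i ++ concat ps) f (concat rs)
cut-factor [] [] _ _ ()
cut-factor [] (_ ∷ _) _ _ ()
cut-factor {i} {l ∷ ls} (F ∷ _) [] f rs refl
  rewrite ++-identityʳ (segment 0 i) | concat-cut (i + l) ls = factor⇒isLZFactor F
cut-factor {i} {l ∷ ls} (_ ∷ Fs) (p ∷ ps) f rs eq with ∷-injective eq
... | refl , eq′ =
  subst (λ w → IsLZFactor w f (concat rs))
    (trans (cong (_++ concat ps) (sym (segment-++ 0 i l)))
      (++-assoc (segment 0 i) (segment i l) (concat ps)))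
    (cut-factor Fs ps f rs eq′)

cut-isLZFactorization : ∀ {ls} → Factorized 0 ls → IsLZFactorization (segment 0 (sum ls)) (cut 0 ls)
cut-isLZFactorization {ls} Fs = record
  { concat≡ = concat-cut 0 ls ; nonEmpty = cut-nonEmpty Fs ; factor = cut-factor Fs }

-- Uniqueness of the factorization lets any exhibited one count the factors, without evaluating `z`.
z-t : ∀ n {ls} → Factorized 0 ls → sum ls ≡ 2 ^ n → z (t n) ≡ length ls
z-t n {ls} Fs eq = trans
  (cong length (lzFactorization-unique (proj₂ (lzFactorization (t n)))
    (subst (λ w → IsLZFactorization w (cut 0 ls))
      (trans (cong (segment 0) eq) (sym (t≡segment n))) (cut-isLZFactorization Fs))))
  (length-cut 0 ls)

-- Factorizations of the Thue-Morse words

-- The factor lengths of t (4 + m) from position 13 on.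
tail : ℕ → List ℕ
tail zero    = 3 ∷ []
tail (suc m) = 7 ∷ 6 ∷ map (2 *_) (tail m)

tail-≥2 : ∀ m → All (2 ≤_) (tail m)
tail-≥2 zero    = s≤s (s≤s z≤n) ∷ []
tail-≥2 (suc m) = s≤s (s≤s z≤n) ∷ s≤s (s≤s z≤n) ∷
  map⁺ (All.map (λ {l} 2≤l → ≤-trans 2≤l (m≤m+n l (l + 0))) (tail-≥2 m))

length-tail : ∀ m → length (tail m) ≡ 1 + 2 * m
length-tail zero    = refl
length-tail (suc m) = trans
  (cong (2 +_) (trans (length-map (2 *_) (tail m)) (length-tail m)))
  (cong suc (sym (*-suc 2 m)))

sum-tail : ∀ m → 13 + sum (tail m) ≡ 2 ^ (4 + m)
sum-tail zero    = refl
sum-tail (suc m) = trans (cong (26 +_) (sum-double (tail m)))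
  (trans (sym (*-distribˡ-+ 2 13 (sum (tail m)))) (cong (2 *_) (sum-tail m)))

tail-factorized : ∀ m → Factorized 13 (tail m)
-- Three letters separate position 13 from the end of the 16-letter `t 4`.
tail-factorized zero    = final (from-yes (reoccurs? 13 3)) ∷ []
tail-factorized (suc m) =
  maximal (from-yes (reoccurs? 13 7)) (from-no (reoccurs? 13 8)) ∷
  maximal (from-yes (reoccurs? 20 6)) (from-no (reoccurs? 20 7)) ∷
  -- Since `13 + 7 + 6 = 2 * 13`, the doubled factorization starts exactly where the factor of
  -- length 6 ends.
  factorized-double (tail-≥2 m) (tail-factorized m)

-- The seven initial factors leave `r` arbitrary, so all `n` can share them. Where the text ends
-- inside one, at position 3 for `t 2` and 6 for `t 3`, `final` replaces it.
first : ∀ {r} → Factor 0 1 r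
first = literal (from-no (reoccurs? 0 1))

second : ∀ {r} → Factor 1 1 r
second = literal (from-no (reoccurs? 1 1))

third : ∀ {r} → Factor 2 1 r
third = maximal (from-yes (reoccurs? 2 1)) (from-no (reoccurs? 2 2))

fourth : ∀ {r} → Factor 3 2 r
fourth = maximal (from-yes (reoccurs? 3 2)) (from-no (reoccurs? 3 3))

fifth : ∀ {r} → Factor 5 1 r
fifth = maximal (from-yes (reoccurs? 5 1)) (from-no (reoccurs? 5 2))

sixth : ∀ {r} → Factor 6 4 r
sixth = maximal (from-yes (reoccurs? 6 4)) (from-no (reoccurs? 6 5))

seventh : ∀ {r} → Factor 10 3 r
seventh = maximal (from-yes (reoccurs? 10 3)) (from-no (reoccurs? 10 4))

theorem5 : (n : ℕ) → n ≥ 1 → z (t n) ≡ 2 * n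
theorem5 1 _ = z-t 1 (first ∷ second ∷ []) refl
theorem5 2 _ = z-t 2 (first ∷ second ∷ third ∷ final (from-yes (reoccurs? 3 1)) ∷ []) refl
theorem5 3 _ =
  z-t 3 (first ∷ second ∷ third ∷ fourth ∷ fifth ∷ final (from-yes (reoccurs? 6 2)) ∷ []) refl
theorem5 (suc (suc (suc (suc m)))) _ = trans
  (z-t (4 + m)
    (first ∷ second ∷ third ∷ fourth ∷ fifth ∷ sixth ∷ seventh ∷ tail-factorized m)
    (sum-tail m))
  -- Seven initial factors and `1 + 2 * m` in the tail make `8 + 2 * m`.
  (trans (cong (7 +_) (length-tail m)) (sym (*-distribˡ-+ 2 4 m)))
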